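{- For $m,n\ge2$, \[ \sum_{k=2}^m\sum_{l=2}^n\frac{(-1)^{k+l}G_{k,l}}{m-k+n-l+1}=\frac{1}{m+n-1}-\frac{1}{mn}. \]
   Context: The generalized Gregory coefficients $G_{m,n}$ are defined by $\sum_{m,n\ge0}G_{m,n}x^my^n=\dfrac{y\log^2(1+x)-x\log^2(1+y)}{\log(1+x)-\log(1+y)}$ (formal power series; $\log^ku=(\log u)^k$). -}

module Defs where

open import Data.Fin.Base using (toℕ)
open import Data.Integer.Base as ℤ using (-1ℤ)
open import Data.Nat.Base as ℕ using (ℕ; zero; suc; _∸_; _≤_; s≤s; z≤n; NonZero; >-nonZero)
open import Data.Nat.Properties using (m*n≢0; ≤-trans; m≤m+n; ∸-monoˡ-≤)
open import Data.Rational using (ℚ; 0ℚ; 1ℚ; _*_; _-_; _/_)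
open import Data.Rational.Properties using (+-0-commutativeMonoid)
open import Relation.Binary.PropositionalEquality using (_≡_)

open import Algebra.Properties.CommutativeMonoid.Sum +-0-commutativeMonoid public
  using (sum; sum-syntax; sum⁺-syntax)

-- Both endpoints are included; the sum is empty when b < a.
sumFromTo : ℕ → ℕ → (ℕ → ℚ) → ℚ
sumFromTo a b f = ∑[ i < suc b ∸ a ] f (a ℕ.+ toℕ i)

infixl 6 sumFromTo
syntax sumFromTo a b (λ k → e) = ∑[ k from a to b ] e

-- An element F of ℚ[[x,y]]; F m n is the coefficient of x^m y^n.
Series : Set
Series = ℕ → ℕ → ℚ

infix  4 _≐_
infixl 6 _⊖_
infixl 7 _⊛_
infixl 8 _²

_≐_ : Series → Series → Set
F ≐ H = ∀ m n → F m n ≡ H m n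

_⊖_ : Series → Series → Series
(F ⊖ H) m n = F m n - H m n

_⊛_ : Series → Series → Series
(F ⊛ H) m n = ∑[ i ≤ m ] ∑[ j ≤ n ] (F (toℕ i) (toℕ j) * H (m ∸ toℕ i) (n ∸ toℕ j))

_² : Series → Series
F ² = F ⊛ F

-- f(x) and f(y), for f ∈ ℚ[[t]] given by its coefficients.
at-x : (ℕ → ℚ) → Series
at-x f m zero    = f m
at-x f m (suc n) = 0ℚ

at-y : (ℕ → ℚ) → Series
at-y f m n = at-x f n m

-- The indeterminate t of ℚ[[t]].
var : ℕ → ℚ
var 1 = 1ℚ
var _ = 0ℚ

-- log(1+t) = Σ_{k≥0} (-1)^k t^(k+1) / (k+1).
log1+ : ℕ → ℚ
log1+ zero    = 0ℚ
log1+ (suc k) = (-1ℤ ℤ.^ k) / suc k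

X Y log[1+X] log[1+Y] : Series
X        = at-x var
Y        = at-y var
log[1+X] = at-x log1+
log[1+Y] = at-y log1+

-- F = N / D in ℚ[[x,y]].  As ℚ[[x,y]] is an integral domain, for D ≠ 0 there
-- is at most one such F, even when (as below) D is not a unit.
IsQuotient : (F N D : Series) → Set
IsQuotient F N D = F ⊛ D ≐ N

-- G is the generating function of the generalized Gregory coefficients,
-- that is, G m n = G_{m,n}.  The quotient exists because x - y divides the
-- numerator and the denominator is x - y times a unit.
IsGeneralizedGregory : Series → Set
IsGeneralizedGregory G =
  IsQuotient G (Y ⊛ log[1+X] ² ⊖ X ⊛ log[1+Y] ²) (log[1+X] ⊖ log[1+Y])

m+n∸1≢0 : ∀ {m n} → 2 ≤ m → 2 ≤ n → NonZero (m ℕ.+ n ∸ 1)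
m+n∸1≢0 {m} {n} 2≤m _ = >-nonZero (∸-monoˡ-≤ 1 (≤-trans 2≤m (m≤m+n m n)))

mn≢0 : ∀ {m n} → 2 ≤ m → 2 ≤ n → NonZero (m ℕ.* n)
mn≢0 {m} {n} 2≤m 2≤n =
  m*n≢0 m n {{>-nonZero (≤-trans (s≤s z≤n) 2≤m)}} {{>-nonZero (≤-trans (s≤s z≤n) 2≤n)}}

{-# OPTIONS --safe #-}
-- Write A = log (1+x), B = log (1+y) and K = (A - B) / (x - y), whose coefficient at x^i y^j is
-- (-1)^(i+j) / (i+j+1).  Cancelling x - y in the defining equation of G gives
-- G K + A B = (y A + x B) K, that is, H K = x y K - A B for H = G - y A - x B + x y.
-- The right-hand side has no terms in which x or y has exponent at most 1, and K has constant
-- coefficient 1, so H has no such terms either: H is the part of G over which the sum ranges.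
-- Up to the sign (-1)^(m+n), the theorem is the coefficient of x^m y^n in H K = x y K - A B.
module Submission where

open import Algebra.Bundles using (CommutativeRing)
import Algebra.Construct.Pointwise as Pointwise
import Algebra.Properties.CommutativeSemigroup as CommutativeSemigroupProperties
import Algebra.Properties.Ring as RingProperties
import Algebra.Properties.Semiring.Sum as SemiringSum
import Algebra.Solver.Ring.NaturalCoefficients.Default as SemiringSolver
open import Data.Fin.Base using (toℕ)
open import Data.Nat.Base as ℕ using (ℕ; zero; suc; _∸_; _≤_; z≤n; s≤s)
import Data.Nat.Properties as ℕ
open import Data.Product.Base using (_,_)
open import Function.Base using (_∘_; flip)
import Relation.Binary.Reasoning.Setoid as SetoidReasoning

-- Formal power series in one variable over a commutative ring

module PowerSeries {c ℓ} (R : CommutativeRing c ℓ) where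
  open CommutativeRing R
  open CommutativeSemigroupProperties +-commutativeSemigroup using (interchange; x∙yz≈y∙xz)
  open SemiringSum semiring using (sum⁺-syntax; sum-cong-≋)
  open SetoidReasoning setoid

  module Coefficientwise = CommutativeRing (Pointwise.commutativeRing ℕ R)
  open Coefficientwise public using () renaming (_≈_ to _≈ˢ_; _+_ to _+ˢ_)

  infixl 7 _*ˢ_

  _*ˢ_ : (f g : ℕ → Carrier) → ℕ → Carrier
  (f *ˢ g) n = ∑[ i ≤ n ] (f (toℕ i) * g (n ∸ toℕ i))

  constant : Carrier → ℕ → Carrier
  constant a zero    = a
  constant a (suc n) = 0#

  *ˢ-cong : ∀ {f g h k} → f ≈ˢ g → h ≈ˢ k → f *ˢ h ≈ˢ g *ˢ k
  *ˢ-cong f≈g h≈k n = sum-cong-≋ {suc n} λ i → *-cong (f≈g (toℕ i)) (h≈k (n ∸ toℕ i))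

  *ˢ-zeroˡ : ∀ f → (∀ n → f n ≈ 0#) → ∀ g n → (f *ˢ g) n ≈ 0#
  *ˢ-zeroˡ f f≈0 g zero    = trans (+-identityʳ _) (trans (*-congʳ (f≈0 0)) (zeroˡ _))
  *ˢ-zeroˡ f f≈0 g (suc n) = trans
    (+-cong (trans (*-congʳ (f≈0 0)) (zeroˡ _)) (*ˢ-zeroˡ (f ∘ suc) (f≈0 ∘ suc) g n))
    (+-identityʳ _)

  -- Stated for every `f` with vanishing higher coefficients instead of for `constant a`, so that it
  -- also covers `at-x f m`, `at-y f` and the tail of a variable.
  constant-*ˢ : ∀ f → (∀ n → f (suc n) ≈ 0#) → ∀ g n → (f *ˢ g) n ≈ f 0 * g n
  constant-*ˢ f f≈0 g zero    = +-identityʳ _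
  constant-*ˢ f f≈0 g (suc n) = trans (+-congˡ (*ˢ-zeroˡ (f ∘ suc) f≈0 g n)) (+-identityʳ _)

  distribʳˢ : ∀ h f g → (f +ˢ g) *ˢ h ≈ˢ f *ˢ h +ˢ g *ˢ h
  distribʳˢ h f g zero    = begin
    (f 0 + g 0) * h 0 + 0#               ≈⟨ +-cong (distribʳ _ _ _) (sym (+-identityʳ _)) ⟩
    (f 0 * h 0 + g 0 * h 0) + (0# + 0#)  ≈⟨ interchange _ _ _ _ ⟩
    (f 0 * h 0 + 0#) + (g 0 * h 0 + 0#)  ∎
  distribʳˢ h f g (suc n) = trans
    (+-cong (distribʳ _ _ _) (distribʳˢ h (f ∘ suc) (g ∘ suc) n))
    (interchange _ _ _ _)

  scale-*ˢ : ∀ a f g n → ((λ i → a * f i) *ˢ g) n ≈ a * (f *ˢ g) n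
  scale-*ˢ a f g zero    = begin
    a * f 0 * g 0 + 0#    ≈⟨ +-identityʳ _ ⟩
    a * f 0 * g 0         ≈⟨ *-assoc _ _ _ ⟩
    a * (f 0 * g 0)       ≈⟨ *-congˡ (+-identityʳ _) ⟨
    a * (f 0 * g 0 + 0#)  ∎
  scale-*ˢ a f g (suc n) = trans
    (+-cong (*-assoc _ _ _) (scale-*ˢ a (f ∘ suc) g n))
    (sym (distribˡ _ _ _))

  -- The definition of *ˢ computes to (f *ˢ g) (suc n) = f 0 * g (suc n) + (tail f *ˢ g) n;
  -- this is the recursion on the other factor.
  *ˢ-sucʳ : ∀ f g n → (f *ˢ g) (suc n) ≈ f (suc n) * g 0 + (f *ˢ (g ∘ suc)) n
  *ˢ-sucʳ f g zero    = x∙yz≈y∙xz _ _ _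
  *ˢ-sucʳ f g (suc n) = trans (+-congˡ (*ˢ-sucʳ (f ∘ suc) g n)) (x∙yz≈y∙xz _ _ _)

  *ˢ-comm : ∀ f g → f *ˢ g ≈ˢ g *ˢ f
  *ˢ-comm f g zero    = +-congʳ (*-comm _ _)
  *ˢ-comm f g (suc n) = begin
    f 0 * g (suc n) + ((f ∘ suc) *ˢ g) n  ≈⟨ +-cong (*-comm _ _) (*ˢ-comm (f ∘ suc) g n) ⟩
    g (suc n) * f 0 + (g *ˢ (f ∘ suc)) n  ≈⟨ *ˢ-sucʳ g f n ⟨
    (g *ˢ f) (suc n)                      ∎

  -- The tail of `f *ˢ g` is `f 0` times the tail of `g`, plus the tail of `f` times `g`.
  -- Distributivity and scaling then reduce the claim to the induction hypothesis for the tail of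
  -- `f`.
  *ˢ-assoc : ∀ f g h → (f *ˢ g) *ˢ h ≈ˢ f *ˢ (g *ˢ h)
  *ˢ-assoc f g h zero    = begin
    (f 0 * g 0 + 0#) * h 0 + 0#  ≈⟨ +-congʳ (*-congʳ (+-identityʳ _)) ⟩
    f 0 * g 0 * h 0 + 0#         ≈⟨ +-congʳ (*-assoc _ _ _) ⟩
    f 0 * (g 0 * h 0) + 0#       ≈⟨ +-congʳ (*-congˡ (+-identityʳ _)) ⟨
    f 0 * (g 0 * h 0 + 0#) + 0#  ∎
  *ˢ-assoc f g h (suc n) = begin
    (f 0 * g 0 + 0#) * h (suc n) + (((λ i → f 0 * g (suc i)) +ˢ f⁺ *ˢ g) *ˢ h) n
      ≈⟨ +-cong (trans (*-congʳ (+-identityʳ _)) (*-assoc _ _ _)) (distribʳˢ h (λ i → f 0 * g (suc i)) (f⁺ *ˢ g) n) ⟩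
    f 0 * (g 0 * h (suc n)) + (((λ i → f 0 * g (suc i)) *ˢ h) n + ((f⁺ *ˢ g) *ˢ h) n)
      ≈⟨ +-congˡ (+-cong (scale-*ˢ (f 0) (g ∘ suc) h n) (*ˢ-assoc f⁺ g h n)) ⟩
    f 0 * (g 0 * h (suc n)) + (f 0 * ((g ∘ suc) *ˢ h) n + (f⁺ *ˢ (g *ˢ h)) n)
      ≈⟨ +-assoc _ _ _ ⟨
    f 0 * (g 0 * h (suc n)) + f 0 * ((g ∘ suc) *ˢ h) n + (f⁺ *ˢ (g *ˢ h)) n
      ≈⟨ +-congʳ (distribˡ _ _ _) ⟨
    f 0 * (g *ˢ h) (suc n) + (f⁺ *ˢ (g *ˢ h)) n
      ∎
    where
    f⁺ : ℕ → Carrier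
    f⁺ = f ∘ suc

  *ˢ-identityˡ : ∀ f → constant 1# *ˢ f ≈ˢ f
  *ˢ-identityˡ f n = trans (constant-*ˢ (constant 1#) (λ _ → refl) f n) (*-identityˡ _)

  -- Packaged as a `CommutativeRing` so that the construction can be iterated to obtain series in
  -- two variables.
  commutativeRing : CommutativeRing c ℓ
  commutativeRing = record
    { _*_ = _*ˢ_
    ; 1#  = constant 1#
    ; isCommutativeRing = record
      { isRing = record
        { +-isAbelianGroup = Coefficientwise.+-isAbelianGroup
        ; *-cong     = *ˢ-cong
        ; *-assoc    = *ˢ-assoc
        ; *-identity = *ˢ-identityˡ
                     , λ f n → trans (*ˢ-comm f (constant 1#) n) (*ˢ-identityˡ f n)
        ; distrib    = (λ h f g n → trans (*ˢ-comm h (f +ˢ g) n)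
                         (trans (distribʳˢ h f g n) (+-cong (*ˢ-comm f h n) (*ˢ-comm g h n))))
                     , distribʳˢ
        }
      ; *-comm = *ˢ-comm
      }
    }

  -- The coefficients are fixed only up to `_≈_`: those of `X` are themselves series in y, which
  -- agree with the constants 0 and 1 pointwise.
  record IsVariable (t : ℕ → Carrier) : Set ℓ where
    field
      coeff₀  : t 0 ≈ 0#
      coeff₁  : t 1 ≈ 1#
      coeff₂₊ : ∀ n → t (suc (suc n)) ≈ 0#

    *ˢ-coeff-zero : ∀ f → (t *ˢ f) 0 ≈ 0#
    *ˢ-coeff-zero f = trans (+-identityʳ _) (trans (*-congʳ coeff₀) (zeroˡ _))

    *ˢ-coeff-suc : ∀ f n → (t *ˢ f) (suc n) ≈ f n
    *ˢ-coeff-suc f n = begin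
      t 0 * f (suc n) + ((t ∘ suc) *ˢ f) n  ≈⟨ +-cong (trans (*-congʳ coeff₀) (zeroˡ _)) (constant-*ˢ (t ∘ suc) coeff₂₊ f n) ⟩
      0# + t 1 * f n                        ≈⟨ +-identityˡ _ ⟩
      t 1 * f n                             ≈⟨ *-congʳ coeff₁ ⟩
      1# * f n                              ≈⟨ *-identityˡ _ ⟩
      f n                                   ∎

  -- The coefficients of `f` are eliminated one at a time: once `f 0` vanishes, the product of the
  -- tail of `f` with `k` is `f *ˢ k` shifted by one. Cancellability of `k 0` is assumed as such
  -- because `k 0` may itself be a power series.
  *ˢ-vanishing : ∀ {k} → (∀ a → a * k 0 ≈ 0# → a ≈ 0#) →
                 ∀ n f → (∀ i → i ≤ n → (f *ˢ k) i ≈ 0#) → f n ≈ 0#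
  *ˢ-vanishing     k₀-cancel zero    f fk≈0 = k₀-cancel (f 0) (trans (sym (+-identityʳ _)) (fk≈0 0 z≤n))
  *ˢ-vanishing {k} k₀-cancel (suc n) f fk≈0 = *ˢ-vanishing k₀-cancel n (f ∘ suc) λ i i≤n → begin
    ((f ∘ suc) *ˢ k) i                    ≈⟨ +-identityˡ _ ⟨
    0# + ((f ∘ suc) *ˢ k) i               ≈⟨ +-congʳ (trans (*-congʳ f₀≈0) (zeroˡ _)) ⟨
    f 0 * k (suc i) + ((f ∘ suc) *ˢ k) i  ≈⟨ fk≈0 (suc i) (s≤s i≤n) ⟩
    0#                                    ∎
    where
    f₀≈0 : f 0 ≈ 0#
    f₀≈0 = *ˢ-vanishing k₀-cancel 0 f λ i i≤0 → fk≈0 i (ℕ.≤-trans i≤0 z≤n)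

-- Ring identities for eliminating the quotients

module QuotientIdentities {c ℓ} (R : CommutativeRing c ℓ) where
  open CommutativeRing R
  open CommutativeSemigroupProperties +-commutativeSemigroup using (xy∙z≈xz∙y)
  open RingProperties ring using (//-rightDividesˡ; +-cancelʳ; x[y-z]≈xy-xz)
  open SetoidReasoning setoid
  open SemiringSolver commutativeSemiring using (solve; _:+_; _:*_; _:=_)

  x-y≈z-w⇒x+w≈z+y : ∀ {x y z w} → x - y ≈ z - w → x + w ≈ z + y
  x-y≈z-w⇒x+w≈z+y {x} {y} {z} {w} eq = begin
    x + w          ≈⟨ +-congʳ (//-rightDividesˡ y x) ⟨
    x - y + y + w  ≈⟨ +-congʳ (+-congʳ eq) ⟩
    z - w + y + w  ≈⟨ xy∙z≈xz∙y _ _ _ ⟩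
    z - w + w + y  ≈⟨ +-congʳ (//-rightDividesˡ w z) ⟩
    z + y          ∎

  module _ (x y a b g k : Carrier) where

    -- This is (x - y) * (g * k + a * b) ≈ (x - y) * ((y * a + x * b) * k) with both sides moved
    -- so that no subtraction occurs.
    quotient-identity :
      g * (a - b) ≈ y * (a * a) - x * (b * b) →
      a + y * k ≈ b + x * k →
      x * (g * k + a * b) + y * ((y * a + x * b) * k) ≈
      x * ((y * a + x * b) * k) + y * (g * k + a * b)
    -- The added `g * b` completes `x * (g * k)` to `g * (b + x * k)`, and `x * (b * b)` completes
    -- the resulting `g * a` to one side of the equation for `g` without subtraction.
    quotient-identity g-quotient k-quotient = +-cancelʳ (g * b + x * (b * b)) _ _ (begin
      x * (g * k + a * b) + y * ((y * a + x * b) * k) + (g * b + x * (b * b))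
        ≈⟨ solve 6 (λ x y a b g k →
             x :* (g :* k :+ a :* b) :+ y :* ((y :* a :+ x :* b) :* k) :+ (g :* b :+ x :* (b :* b)) :=
             g :* (b :+ x :* k) :+ x :* (b :* b) :+ (x :* (a :* b) :+ y :* ((y :* a :+ x :* b) :* k)))
             refl x y a b g k ⟩
      g * (b + x * k) + x * (b * b) + (x * (a * b) + y * ((y * a + x * b) * k))
        ≈⟨ +-congʳ (+-congʳ (*-congˡ k-quotient)) ⟨
      g * (a + y * k) + x * (b * b) + (x * (a * b) + y * ((y * a + x * b) * k))
        ≈⟨ solve 6 (λ x y a b g k →
             g :* (a :+ y :* k) :+ x :* (b :* b) :+ (x :* (a :* b) :+ y :* ((y :* a :+ x :* b) :* k)) :=
             (g :* a :+ x :* (b :* b)) :+ (g :* (y :* k) :+ (x :* (a :* b) :+ y :* ((y :* a :+ x :* b) :* k))))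
             refl x y a b g k ⟩
      (g * a + x * (b * b)) + (g * (y * k) + (x * (a * b) + y * ((y * a + x * b) * k)))
        ≈⟨ +-congʳ (x-y≈z-w⇒x+w≈z+y (trans (sym (x[y-z]≈xy-xz g a b)) g-quotient)) ⟩
      (y * (a * a) + g * b) + (g * (y * k) + (x * (a * b) + y * ((y * a + x * b) * k)))
        ≈⟨ solve 6 (λ x y a b g k →
             (y :* (a :* a) :+ g :* b) :+ (g :* (y :* k) :+ (x :* (a :* b) :+ y :* ((y :* a :+ x :* b) :* k))) :=
             (g :* b :+ y :* (g :* k)) :+ (y :* a :+ x :* b) :* (a :+ y :* k))
             refl x y a b g k ⟩
      (g * b + y * (g * k)) + (y * a + x * b) * (a + y * k)
        ≈⟨ +-congˡ (*-congˡ k-quotient) ⟩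
      (g * b + y * (g * k)) + (y * a + x * b) * (b + x * k)
        ≈⟨ solve 6 (λ x y a b g k →
             (g :* b :+ y :* (g :* k)) :+ (y :* a :+ x :* b) :* (b :+ x :* k) :=
             x :* ((y :* a :+ x :* b) :* k) :+ y :* (g :* k :+ a :* b) :+ (g :* b :+ x :* (b :* b)))
             refl x y a b g k ⟩
      x * ((y * a + x * b) * k) + y * (g * k + a * b) + (g * b + x * (b * b))
        ∎)

    truncated-identity :
      g * k + a * b ≈ (y * a + x * b) * k →
      (g + x * y - (y * a + x * b)) * k + a * b ≈ x * (y * k)
    truncated-identity eq = +-cancelʳ (g * k) _ _ (begin
      h * k + a * b + g * k
        ≈⟨ solve 5 (λ a b g k h → h :* k :+ a :* b :+ g :* k := h :* k :+ (g :* k :+ a :* b)) refl a b g k h ⟩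
      h * k + (g * k + a * b)
        ≈⟨ +-congˡ eq ⟩
      h * k + (y * a + x * b) * k
        ≈⟨ distribʳ _ _ _ ⟨
      (h + (y * a + x * b)) * k
        ≈⟨ *-congʳ (//-rightDividesˡ _ _) ⟩
      (g + x * y) * k
        ≈⟨ solve 4 (λ x y g k → (g :+ x :* y) :* k := x :* (y :* k) :+ g :* k) refl x y g k ⟩
      x * (y * k) + g * k
        ∎)
      where
      h : Carrier
      h = g + x * y - (y * a + x * b)

open import Defs
open import Data.Fin.Base using (Fin; zero; suc)
open import Data.Fin.Properties using (toℕ≤pred[n])
open import Data.Integer.Base as ℤ using (ℤ; -1ℤ; 1ℤ)
import Data.Integer.Properties as ℤ
open import Data.Rational using (ℚ; 0ℚ; 1ℚ; _+_; _*_; _-_; _/_; toℚᵘ)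
import Data.Rational.Properties as ℚ
open import Data.Rational.Unnormalised.Base as ℚᵘ using (mkℚᵘ)
import Data.Rational.Unnormalised.Properties as ℚᵘ
open import Relation.Binary.PropositionalEquality

-- Products of fractions and powers of -1

-- Checked in the unnormalised rationals, where fractions multiply without division by common
-- factors.
/-*-/ : ∀ i j m n .{{_ : ℕ.NonZero m}} .{{_ : ℕ.NonZero n}} .{{_ : ℕ.NonZero (m ℕ.* n)}} →
        (i / m) * (j / n) ≡ (i ℤ.* j) / (m ℕ.* n)
/-*-/ i j m@(suc a) n@(suc b) = ℚ.toℚᵘ-injective (begin
  toℚᵘ ((i / m) * (j / n))        ≈⟨ ℚ.toℚᵘ-homo-* (i / m) (j / n) ⟩
  toℚᵘ (i / m) ℚᵘ.* toℚᵘ (j / n)  ≈⟨ ℚᵘ.*-cong (ℚ.toℚᵘ-fromℚᵘ (mkℚᵘ i a)) (ℚ.toℚᵘ-fromℚᵘ (mkℚᵘ j b)) ⟩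
  mkℚᵘ i a ℚᵘ.* mkℚᵘ j b          ≈⟨ ℚ.toℚᵘ-fromℚᵘ (mkℚᵘ i a ℚᵘ.* mkℚᵘ j b) ⟨
  toℚᵘ ((i ℤ.* j) / (m ℕ.* n))    ∎)
  where open ℚᵘ.≃-Reasoning

sgn : ℕ → ℤ
sgn n = -1ℤ ℤ.^ n

sgn-+ : ∀ m n → sgn (m ℕ.+ n) ≡ sgn m ℤ.* sgn n
sgn-+ = ℤ.^-distribˡ-+-* -1ℤ

sgn-*-sgn : ∀ n → sgn n ℤ.* sgn n ≡ 1ℤ
sgn-*-sgn zero    = refl
sgn-*-sgn (suc n) = begin
  (-1ℤ ℤ.* sgn n) ℤ.* (-1ℤ ℤ.* sgn n)  ≡⟨ interchange -1ℤ (sgn n) -1ℤ (sgn n) ⟩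
  1ℤ ℤ.* (sgn n ℤ.* sgn n)             ≡⟨ cong (1ℤ ℤ.*_) (sgn-*-sgn n) ⟩
  1ℤ                                   ∎
  where
  open ≡-Reasoning
  open CommutativeSemigroupProperties ℤ.*-commutativeSemigroup using (interchange)

sgn-2+ : ∀ n → sgn (suc (suc n)) ≡ sgn n
sgn-2+ n = trans (sym (ℤ.*-assoc -1ℤ -1ℤ (sgn n))) (ℤ.*-identityˡ (sgn n))

sgn-+-cancelʳ : ∀ m n → sgn (m ℕ.+ n) ℤ.* sgn n ≡ sgn m
sgn-+-cancelʳ m n = begin
  sgn (m ℕ.+ n) ℤ.* sgn n      ≡⟨ cong (ℤ._* sgn n) (sgn-+ m n) ⟩
  sgn m ℤ.* sgn n ℤ.* sgn n    ≡⟨ ℤ.*-assoc (sgn m) (sgn n) (sgn n) ⟩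
  sgn m ℤ.* (sgn n ℤ.* sgn n)  ≡⟨ cong (sgn m ℤ.*_) (sgn-*-sgn n) ⟩
  sgn m ℤ.* 1ℤ                 ≡⟨ ℤ.*-identityʳ (sgn m) ⟩
  sgn m                        ∎
  where open ≡-Reasoning

sgn-suc-suc : ∀ m n → sgn (suc m ℕ.+ suc n) ≡ sgn (m ℕ.+ n)
sgn-suc-suc m n = trans (cong (λ k → sgn (suc k)) (ℕ.+-suc m n)) (sgn-2+ (m ℕ.+ n))

-- Since `i + (m ∸ i)` is `m` and `j + (n ∸ j)` is `n`, the sign of a summand splits into one
-- independent of `i` and `j` and the sign carried by `kernel (m ∸ i) (n ∸ j)`.
sgn-complement : ∀ {i j m n} → i ≤ m → j ≤ n →
                 sgn (2 ℕ.+ i ℕ.+ (2 ℕ.+ j)) ≡ sgn (m ℕ.+ n) ℤ.* sgn (m ∸ i ℕ.+ (n ∸ j))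
sgn-complement {i} {j} {m} {n} i≤m j≤n = begin
  sgn (2 ℕ.+ i ℕ.+ (2 ℕ.+ j))                        ≡⟨ sgn-suc-suc (suc i) (suc j) ⟩
  sgn (suc i ℕ.+ suc j)                              ≡⟨ sgn-suc-suc i j ⟩
  sgn (i ℕ.+ j)                                      ≡⟨ sgn-+-cancelʳ (i ℕ.+ j) p ⟨
  sgn (i ℕ.+ j ℕ.+ p) ℤ.* sgn p                      ≡⟨ cong (λ k → sgn k ℤ.* sgn p) (interchange i j (m ∸ i) (n ∸ j)) ⟩
  sgn (i ℕ.+ (m ∸ i) ℕ.+ (j ℕ.+ (n ∸ j))) ℤ.* sgn p  ≡⟨ cong₂ (λ k l → sgn (k ℕ.+ l) ℤ.* sgn p) (ℕ.m+[n∸m]≡n i≤m) (ℕ.m+[n∸m]≡n j≤n) ⟩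
  sgn (m ℕ.+ n) ℤ.* sgn p                            ∎
  where
  open ≡-Reasoning
  open CommutativeSemigroupProperties ℕ.+-commutativeSemigroup using (interchange)
  p : ℕ
  p = m ∸ i ℕ.+ (n ∸ j)

/1-*-/ : ∀ i j n .{{_ : ℕ.NonZero n}} → (i / 1) * (j / n) ≡ (i ℤ.* j) / n
/1-*-/ i j n@(suc _) = trans (/-*-/ i j 1 n) (ℚ./-cong {i ℤ.* j} refl (ℕ.*-identityˡ n))

-- Series in two variables as power series in x over ℚ[[y]]

ℚ-ring : CommutativeRing _ _
ℚ-ring = ℚ.+-*-commutativeRing

module ℚ[[y]] = PowerSeries ℚ-ring
module ℚ[[y]][[x]] = PowerSeries ℚ[[y]].commutativeRing

module S₁ = CommutativeRing ℚ[[y]].commutativeRing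
module S₂ = CommutativeRing ℚ[[y]][[x]].commutativeRing
module Σ₁ = SemiringSum S₁.semiring
module Σℚ = SemiringSum (CommutativeRing.semiring ℚ-ring)
module ℚRing = RingProperties (CommutativeRing.ring ℚ-ring)

sum-coeff : ∀ {k} (t : Fin k → ℕ → ℚ) n → Σ₁.sum t n ≡ sum (λ i → t i n)
sum-coeff {zero}  t n = refl
sum-coeff {suc k} t n = cong (t zero n +_) (sum-coeff (λ i → t (suc i)) n)

-- The two products differ only in whether the coefficient at y^n is extracted before or after
-- summing over the powers of x.
⊛≐* : ∀ F H → F ⊛ H ≐ F S₂.* H
⊛≐* F H m n = sym (sum-coeff {suc m} (λ i → F (toℕ i) S₁.* H (m ∸ toℕ i)) n)

-- Interchanging the two finite sums swaps x and y; this later carries the vanishing argument in x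
-- over to y.
flip-⊛ : ∀ F H → flip F ⊛ flip H ≐ flip (F ⊛ H)
flip-⊛ F H m n = Σℚ.∑-comm {suc m} {suc n}
  λ i j → F (toℕ j) (toℕ i) * H (n ∸ toℕ j) (m ∸ toℕ i)

var-isVariable : ℚ[[y]].IsVariable var
var-isVariable = record { coeff₀ = refl ; coeff₁ = refl ; coeff₂₊ = λ _ → refl }

X-isVariable : ℚ[[y]][[x]].IsVariable X
X-isVariable = record
  { coeff₀  = λ { zero → refl ; (suc _) → refl }
  ; coeff₁  = λ { zero → refl ; (suc _) → refl }
  ; coeff₂₊ = λ { _ zero → refl ; _ (suc _) → refl }
  }

module X-var = ℚ[[y]][[x]].IsVariable X-isVariable
module Y-var = ℚ[[y]].IsVariable var-isVariable

at-y-* : ∀ f F m → (at-y f S₂.* F) m S₁.≈ f S₁.* F m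
at-y-* f F m n = ℚ[[y]][[x]].constant-*ˢ (at-y f) (λ _ _ → refl) F m n

Y*-coeff-zero : ∀ F m → (Y S₂.* F) m 0 ≡ 0ℚ
Y*-coeff-zero F m = trans (at-y-* var F m 0) (Y-var.*ˢ-coeff-zero (F m))

Y*-coeff-suc : ∀ F m n → (Y S₂.* F) m (suc n) ≡ F m n
Y*-coeff-suc F m n = trans (at-y-* var F m (suc n)) (Y-var.*ˢ-coeff-suc (F m) n)

at-x-*-at-y : ∀ f g m n → (at-x f S₂.* at-y g) m n ≡ f m * g n
at-x-*-at-y f g m n = begin
  (at-x f S₂.* at-y g) m n  ≡⟨ S₂.*-comm (at-x f) (at-y g) m n ⟩
  (at-y g S₂.* at-x f) m n  ≡⟨ at-y-* g (at-x f) m n ⟩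
  (g S₁.* at-x f m) n       ≡⟨ S₁.*-comm g (at-x f m) n ⟩
  (at-x f m S₁.* g) n       ≡⟨ ℚ[[y]].constant-*ˢ (at-x f m) (λ _ → refl) g n ⟩
  f m * g n                 ∎
  where open ≡-Reasoning

-- Induction on the exponent of x. The coefficient at x^(m+1) y^(n+1) relates row `suc m` to row
-- `m`, where `U` and `V` already agree; in row 0 the multiples of `X` contribute nothing.
[X-Y]-cancel : ∀ U V → X S₂.* U S₂.+ Y S₂.* V ≐ X S₂.* V S₂.+ Y S₂.* U → U ≐ V
[X-Y]-cancel U V eq zero n = sym (begin
  V 0 n                                        ≡⟨ ℚ.+-identityˡ _ ⟨
  0ℚ + V 0 n                                   ≡⟨ cong₂ _+_ (X-var.*ˢ-coeff-zero U (suc n)) (Y*-coeff-suc V 0 n) ⟨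
  (X S₂.* U) 0 (suc n) + (Y S₂.* V) 0 (suc n)  ≡⟨ eq 0 (suc n) ⟩
  (X S₂.* V) 0 (suc n) + (Y S₂.* U) 0 (suc n)  ≡⟨ cong₂ _+_ (X-var.*ˢ-coeff-zero V (suc n)) (Y*-coeff-suc U 0 n) ⟩
  0ℚ + U 0 n                                   ≡⟨ ℚ.+-identityˡ _ ⟩
  U 0 n                                        ∎)
  where open ≡-Reasoning
[X-Y]-cancel U V eq (suc m) n = sym (ℚRing.+-cancelˡ (U m (suc n)) _ _ (begin
  U m (suc n) + V (suc m) n                                ≡⟨ cong₂ _+_ (X-var.*ˢ-coeff-suc U m (suc n)) (Y*-coeff-suc V (suc m) n) ⟨
  (X S₂.* U) (suc m) (suc n) + (Y S₂.* V) (suc m) (suc n)  ≡⟨ eq (suc m) (suc n) ⟩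
  (X S₂.* V) (suc m) (suc n) + (Y S₂.* U) (suc m) (suc n)  ≡⟨ cong₂ _+_ (X-var.*ˢ-coeff-suc V m (suc n)) (Y*-coeff-suc U (suc m) n) ⟩
  V m (suc n) + U (suc m) n                                ≡⟨ cong (_+ U (suc m) n) ([X-Y]-cancel U V eq m (suc n)) ⟨
  U m (suc n) + U (suc m) n                                ∎))
  where open ≡-Reasoning

-- The kernel K and the low-order terms of x y K

-- (log (1+x) - log (1+y)) / (x - y)
kernel : Series
kernel i j = log1+ (suc (i ℕ.+ j))

-- The entries of `kernel` depend only on `i + j`, so in (x - y) K all mixed terms cancel and only
-- the pure powers of x and of y survive.
kernel-quotient : log[1+X] S₂.+ Y S₂.* kernel ≐ log[1+Y] S₂.+ X S₂.* kernel
kernel-quotient zero zero =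
  cong₂ _+_ (refl {x = 0ℚ}) (trans (Y*-coeff-zero kernel 0) (sym (X-var.*ˢ-coeff-zero kernel 0)))
kernel-quotient zero (suc n) = begin
  0ℚ + (Y S₂.* kernel) 0 (suc n)             ≡⟨ ℚ.+-identityˡ _ ⟩
  (Y S₂.* kernel) 0 (suc n)                  ≡⟨ Y*-coeff-suc kernel 0 n ⟩
  log1+ (suc n)                              ≡⟨ ℚ.+-identityʳ _ ⟨
  log1+ (suc n) + 0ℚ                         ≡⟨ cong (log1+ (suc n) +_) (X-var.*ˢ-coeff-zero kernel (suc n)) ⟨
  log1+ (suc n) + (X S₂.* kernel) 0 (suc n)  ∎
  where open ≡-Reasoning
kernel-quotient (suc m) zero = begin
  log1+ (suc m) + (Y S₂.* kernel) (suc m) 0  ≡⟨ cong (log1+ (suc m) +_) (Y*-coeff-zero kernel (suc m)) ⟩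
  log1+ (suc m) + 0ℚ                         ≡⟨ ℚ.+-identityʳ _ ⟩
  log1+ (suc m)                              ≡⟨ cong (λ k → log1+ (suc k)) (ℕ.+-identityʳ m) ⟨
  kernel m 0                                 ≡⟨ X-var.*ˢ-coeff-suc kernel m 0 ⟨
  (X S₂.* kernel) (suc m) 0                  ≡⟨ ℚ.+-identityˡ _ ⟨
  0ℚ + (X S₂.* kernel) (suc m) 0             ∎
  where open ≡-Reasoning
kernel-quotient (suc m) (suc n) = cong (0ℚ +_) (begin
  (Y S₂.* kernel) (suc m) (suc n)  ≡⟨ Y*-coeff-suc kernel (suc m) n ⟩
  log1+ (suc (suc m ℕ.+ n))        ≡⟨ cong (λ k → log1+ (suc k)) (ℕ.+-suc m n) ⟨
  kernel m (suc n)                 ≡⟨ X-var.*ˢ-coeff-suc kernel m (suc n) ⟨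
  (X S₂.* kernel) (suc m) (suc n)  ∎)
  where open ≡-Reasoning

-- The one-variable result is used twice: in x over ℚ[[y]], and in y over ℚ to show that `K 0`,
-- having constant coefficient 1, can be cancelled in ℚ[[y]].
*-vanishing : ∀ F K → K 0 0 ≡ 1ℚ → ∀ m →
              (∀ i → i ≤ m → ∀ n → (F ⊛ K) i n ≡ 0ℚ) → ∀ n → F m n ≡ 0ℚ
*-vanishing F K K₀₀≡1 m FK≡0 = ℚ[[y]][[x]].*ˢ-vanishing K₀-cancel m F
  λ i i≤m n → trans (sym (⊛≐* F K i n)) (FK≡0 i i≤m n)
  where
  K₀-cancel : ∀ a → a S₁.* K 0 S₁.≈ S₁.0# → a S₁.≈ S₁.0#
  K₀-cancel a aK₀≈0 n = ℚ[[y]].*ˢ-vanishing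
    (λ q qK₀₀≡0 → trans (sym (trans (cong (q *_) K₀₀≡1) (ℚ.*-identityʳ q))) qK₀₀≡0)
    n a (λ i _ → aK₀≈0 i)

XYkernel : Series
XYkernel = X S₂.* (Y S₂.* kernel)

XYkernel-suc-suc : ∀ m n → XYkernel (suc m) (suc n) ≡ kernel m n
XYkernel-suc-suc m n = trans (X-var.*ˢ-coeff-suc (Y S₂.* kernel) m (suc n)) (Y*-coeff-suc kernel m n)

XYkernel-zeroʳ : ∀ m → XYkernel m 0 ≡ 0ℚ
XYkernel-zeroʳ zero    = X-var.*ˢ-coeff-zero (Y S₂.* kernel) 0
XYkernel-zeroʳ (suc m) = trans (X-var.*ˢ-coeff-suc (Y S₂.* kernel) m 0) (Y*-coeff-zero kernel m)

-- At x^0 both sides vanish. At x^1 the left side is the coefficient of y K(0,y) = log (1+y), and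
-- log (1+x) has coefficient 1 there.
XYkernel-lowˡ : ∀ i → i ≤ 1 → ∀ n → XYkernel i n ≡ log1+ i * log1+ n
XYkernel-lowˡ zero    i≤1 n = trans (X-var.*ˢ-coeff-zero (Y S₂.* kernel) n) (sym (ℚ.*-zeroˡ (log1+ n)))
XYkernel-lowˡ (suc .0) (s≤s z≤n) zero = trans (XYkernel-zeroʳ 1) (sym (ℚ.*-zeroʳ 1ℚ))
XYkernel-lowˡ (suc .0) (s≤s z≤n) (suc n) = trans (XYkernel-suc-suc 0 n) (sym (ℚ.*-identityˡ _))

XYkernel-lowʳ : ∀ j → j ≤ 1 → ∀ m → XYkernel m j ≡ log1+ m * log1+ j
XYkernel-lowʳ zero    j≤1 m = trans (XYkernel-zeroʳ m) (sym (ℚ.*-zeroʳ (log1+ m)))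
XYkernel-lowʳ (suc .0) (s≤s z≤n) zero = XYkernel-lowˡ 0 z≤n 1
XYkernel-lowʳ (suc .0) (s≤s z≤n) (suc m) = begin
  XYkernel (suc m) 1     ≡⟨ XYkernel-suc-suc m 0 ⟩
  log1+ (suc (m ℕ.+ 0))  ≡⟨ cong (λ k → log1+ (suc k)) (ℕ.+-identityʳ m) ⟩
  log1+ (suc m)          ≡⟨ ℚ.*-identityʳ _ ⟨
  log1+ (suc m) * 1ℚ     ∎
  where open ≡-Reasoning

-- The truncated Gregory series and its product with K

-- For a generalized Gregory series, y log (1+x) + x log (1+y) - x y collects exactly the terms
-- in which x or y has exponent at most 1.
truncate : Series → Series
truncate G = G S₂.+ X S₂.* Y S₂.- (Y S₂.* log[1+X] S₂.+ X S₂.* log[1+Y])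

truncate-high : ∀ G k l → truncate G (2 ℕ.+ k) (2 ℕ.+ l) ≡ G (2 ℕ.+ k) (2 ℕ.+ l)
truncate-high G k l = trans
  (cong₂ _-_
    (cong (G _ _ +_) (X-var.*ˢ-coeff-suc Y (suc k) (2 ℕ.+ l)))
    (cong₂ _+_ (Y*-coeff-suc log[1+X] (2 ℕ.+ k) (suc l)) (X-var.*ˢ-coeff-suc log[1+Y] (suc k) (2 ℕ.+ l))))
  (trans (ℚ.+-identityʳ _) (ℚ.+-identityʳ _))

module _ (G : Series) (G-gregory : IsGeneralizedGregory G) where
  open QuotientIdentities ℚ[[y]][[x]].commutativeRing

  private
    A = log[1+X]
    B = log[1+Y]

  gregory-quotient : G S₂.* (A S₂.- B) ≐ Y S₂.* (A S₂.* A) S₂.- X S₂.* (B S₂.* B)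
  gregory-quotient m n = begin
    (G S₂.* (A S₂.- B)) m n                         ≡⟨ ⊛≐* G (A S₂.- B) m n ⟨
    (G ⊛ (A ⊖ B)) m n                               ≡⟨ G-gregory m n ⟩
    (Y ⊛ A ² ⊖ X ⊛ B ²) m n                         ≡⟨ cong₂ _-_ (var-⊛-² Y A) (var-⊛-² X B) ⟩
    (Y S₂.* (A S₂.* A) S₂.- X S₂.* (B S₂.* B)) m n  ∎
    where
    open ≡-Reasoning
    var-⊛-² : ∀ V F → (V ⊛ F ²) m n ≡ (V S₂.* (F S₂.* F)) m n
    var-⊛-² V F = trans (⊛≐* V (F ²) m n) (S₂.*-congˡ {V} (⊛≐* F F) m n)

  kernel-product : G S₂.* kernel S₂.+ A S₂.* B ≐ (Y S₂.* A S₂.+ X S₂.* B) S₂.* kernel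
  kernel-product = [X-Y]-cancel (G S₂.* kernel S₂.+ A S₂.* B) ((Y S₂.* A S₂.+ X S₂.* B) S₂.* kernel)
    (quotient-identity X Y A B G kernel gregory-quotient kernel-quotient)

  truncate-⊛-kernel : ∀ m n → (truncate G ⊛ kernel) m n + log1+ m * log1+ n ≡ XYkernel m n
  truncate-⊛-kernel m n = begin
    (truncate G ⊛ kernel) m n + log1+ m * log1+ n  ≡⟨ cong₂ _+_ (⊛≐* (truncate G) kernel m n) (sym (at-x-*-at-y log1+ log1+ m n)) ⟩
    (truncate G S₂.* kernel S₂.+ A S₂.* B) m n     ≡⟨ truncated-identity X Y A B G kernel kernel-product m n ⟩
    XYkernel m n                                   ∎
    where open ≡-Reasoning

  truncate-⊛-kernel-low : ∀ m n → XYkernel m n ≡ log1+ m * log1+ n → (truncate G ⊛ kernel) m n ≡ 0ℚ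
  truncate-⊛-kernel-low m n low = ℚRing.+-cancelʳ (log1+ m * log1+ n) _ _
    (trans (truncate-⊛-kernel m n) (trans low (sym (ℚ.+-identityˡ _))))

  truncate-lowˡ : ∀ i → i ≤ 1 → ∀ n → truncate G i n ≡ 0ℚ
  truncate-lowˡ m m≤1 = *-vanishing (truncate G) kernel refl m
    λ i i≤m n → truncate-⊛-kernel-low i n (XYkernel-lowˡ i (ℕ.≤-trans i≤m m≤1) n)

  truncate-lowʳ : ∀ j → j ≤ 1 → ∀ m → truncate G m j ≡ 0ℚ
  -- `*-vanishing` runs along the first index, so the columns are treated as rows of the transposed
  -- series.
  truncate-lowʳ n n≤1 = *-vanishing (flip (truncate G)) (flip kernel) refl n
    λ j j≤n m → trans (flip-⊛ (truncate G) kernel j m)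
      (truncate-⊛-kernel-low m j (XYkernel-lowʳ j (ℕ.≤-trans j≤n n≤1) m))

-- Comparison of the coefficients at x^m y^n

sum-zero : ∀ {n} (t : Fin n → ℚ) → (∀ i → t i ≡ 0ℚ) → sum t ≡ 0ℚ
sum-zero {n} t t≡0 = trans (Σℚ.sum-cong-≗ t≡0) (Σℚ.sum-replicate-zero n)

sum-drop₂ : ∀ {n} (t : Fin (2 ℕ.+ n) → ℚ) → t zero ≡ 0ℚ → t (suc zero) ≡ 0ℚ →
            sum t ≡ ∑[ i < n ] t (suc (suc i))
sum-drop₂ t t₀≡0 t₁≡0 = trans (cong₂ (λ p q → p + (q + sum (λ i → t (suc (suc i))))) t₀≡0 t₁≡0)
  (trans (ℚ.+-identityˡ _) (ℚ.+-identityˡ _))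

-- Rows and columns 0 and 1 of `F` drop out. Shifting the remaining indices by 2 leaves the
-- differences in the arguments of `K` unchanged.
⊛-truncated : ∀ F K → (∀ i → i ≤ 1 → ∀ n → F i n ≡ 0ℚ) → (∀ j → j ≤ 1 → ∀ m → F m j ≡ 0ℚ) →
              ∀ m n → (F ⊛ K) (2 ℕ.+ m) (2 ℕ.+ n) ≡
              ∑[ i ≤ m ] ∑[ j ≤ n ] (F (2 ℕ.+ toℕ i) (2 ℕ.+ toℕ j) * K (m ∸ toℕ i) (n ∸ toℕ j))
⊛-truncated F K F-lowˡ F-lowʳ m n = trans
  (sum-drop₂ {suc m} row (row≡0 zero z≤n) (row≡0 (suc zero) (s≤s z≤n)))
  (Σℚ.sum-cong-≗ {suc m} λ i → sum-drop₂ {suc n} (term (suc (suc i)))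
    (term≡0 (F-lowʳ 0 z≤n _)) (term≡0 (F-lowʳ 1 (s≤s z≤n) _)))
  where
  term : Fin (3 ℕ.+ m) → Fin (3 ℕ.+ n) → ℚ
  term i j = F (toℕ i) (toℕ j) * K (2 ℕ.+ m ∸ toℕ i) (2 ℕ.+ n ∸ toℕ j)

  row : Fin (3 ℕ.+ m) → ℚ
  row i = sum (term i)

  term≡0 : ∀ {p q} → p ≡ 0ℚ → p * q ≡ 0ℚ
  term≡0 {q = q} p≡0 = trans (cong (_* q) p≡0) (ℚ.*-zeroˡ q)

  row≡0 : ∀ i → toℕ i ≤ 1 → row i ≡ 0ℚ
  row≡0 i i≤1 = sum-zero (term i) λ j → term≡0 (F-lowˡ (toℕ i) i≤1 (toℕ j))

-- The denominator has the form to which `(2 ℕ.+ m) ℕ.+ (2 ℕ.+ n) ∸ 1` computes. The signs cancel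
-- because `suc m ℕ.+ suc n` and `m ℕ.+ n` have the same parity.
signed-kernel : ∀ m n → (sgn (m ℕ.+ n) / 1) * kernel (suc m) (suc n) ≡ 1ℤ / (suc m ℕ.+ suc (suc n))
signed-kernel m n = begin
  (sgn (m ℕ.+ n) / 1) * kernel (suc m) (suc n)  ≡⟨ /1-*-/ (sgn (m ℕ.+ n)) (sgn q) (suc q) ⟩
  (sgn (m ℕ.+ n) ℤ.* sgn q) / suc q             ≡⟨ ℚ./-cong numerator (cong suc (sym (ℕ.+-suc m (suc n)))) ⟩
  1ℤ / (suc m ℕ.+ suc (suc n))                  ∎
  where
  open ≡-Reasoning
  q : ℕ
  q = suc m ℕ.+ suc n
  numerator : sgn (m ℕ.+ n) ℤ.* sgn q ≡ 1ℤ
  numerator = trans (cong (sgn (m ℕ.+ n) ℤ.*_) (sgn-suc-suc m n)) (sgn-*-sgn (m ℕ.+ n))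

signed-log : ∀ m n → (sgn (m ℕ.+ n) / 1) * (log1+ (2 ℕ.+ m) * log1+ (2 ℕ.+ n)) ≡ 1ℤ / ((2 ℕ.+ m) ℕ.* (2 ℕ.+ n))
signed-log m n = begin
  (sgn (m ℕ.+ n) / 1) * (log1+ (2 ℕ.+ m) * log1+ (2 ℕ.+ n))
    ≡⟨ cong ((sgn (m ℕ.+ n) / 1) *_) (/-*-/ (sgn (suc m)) (sgn (suc n)) (2 ℕ.+ m) (2 ℕ.+ n)) ⟩
  (sgn (m ℕ.+ n) / 1) * ((sgn (suc m) ℤ.* sgn (suc n)) / ((2 ℕ.+ m) ℕ.* (2 ℕ.+ n)))
    ≡⟨ /1-*-/ (sgn (m ℕ.+ n)) (sgn (suc m) ℤ.* sgn (suc n)) ((2 ℕ.+ m) ℕ.* (2 ℕ.+ n)) ⟩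
  (sgn (m ℕ.+ n) ℤ.* (sgn (suc m) ℤ.* sgn (suc n))) / ((2 ℕ.+ m) ℕ.* (2 ℕ.+ n))
    ≡⟨ ℚ./-cong numerator (refl {x = (2 ℕ.+ m) ℕ.* (2 ℕ.+ n)}) ⟩
  1ℤ / ((2 ℕ.+ m) ℕ.* (2 ℕ.+ n))
    ∎
  where
  open ≡-Reasoning
  numerator : sgn (m ℕ.+ n) ℤ.* (sgn (suc m) ℤ.* sgn (suc n)) ≡ 1ℤ
  numerator = begin
    sgn (m ℕ.+ n) ℤ.* (sgn (suc m) ℤ.* sgn (suc n))  ≡⟨ cong (sgn (m ℕ.+ n) ℤ.*_) (sgn-+ (suc m) (suc n)) ⟨
    sgn (m ℕ.+ n) ℤ.* sgn (suc m ℕ.+ suc n)          ≡⟨ cong (sgn (m ℕ.+ n) ℤ.*_) (sgn-suc-suc m n) ⟩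
    sgn (m ℕ.+ n) ℤ.* sgn (m ℕ.+ n)                  ≡⟨ sgn-*-sgn (m ℕ.+ n) ⟩
    1ℤ                                               ∎

theorem5p6 : ∀ (G : Series) → IsGeneralizedGregory G →
    ∀ (m n : ℕ) (2≤m : 2 ≤ m) (2≤n : 2 ≤ n) →
    (∑[ k from 2 to m ] (∑[ l from 2 to n ] (((-1ℤ ℤ.^ (k ℕ.+ l)) / suc ((m ∸ k) ℕ.+ (n ∸ l))) * G k l)))
    ≡ (1ℤ / (m ℕ.+ n ∸ 1)) {{m+n∸1≢0 2≤m 2≤n}} - (1ℤ / (m ℕ.* n)) {{mn≢0 2≤m 2≤n}}
theorem5p6 G G-gregory (suc (suc m)) (suc (suc n)) (s≤s (s≤s z≤n)) (s≤s (s≤s z≤n)) = begin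
  -- With both bounds of the form `2 ℕ.+ m` and `2 ℕ.+ n`, the ranges starting at 2 unfold to
  -- `suc m` and `suc n` terms, at k = 2 + i and l = 2 + j.
  ∑[ i ≤ m ] ∑[ j ≤ n ] ((sgn (2 ℕ.+ toℕ i ℕ.+ (2 ℕ.+ toℕ j)) / suc (m ∸ toℕ i ℕ.+ (n ∸ toℕ j))) * G (2 ℕ.+ toℕ i) (2 ℕ.+ toℕ j))
    ≡⟨ Σℚ.sum-cong-≗ {suc m} (λ i → Σℚ.sum-cong-≗ {suc n} (λ j → signed-term (toℕ≤pred[n] i) (toℕ≤pred[n] j))) ⟩
  ∑[ i ≤ m ] ∑[ j ≤ n ] (ε * term i j)
    ≡⟨ Σℚ.sum-cong-≗ {suc m} (λ i → Σℚ.*-distribˡ-sum {suc n} ε (term i)) ⟨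
  ∑[ i ≤ m ] (ε * ∑[ j ≤ n ] term i j)
    ≡⟨ Σℚ.*-distribˡ-sum {suc m} ε (λ i → ∑[ j ≤ n ] term i j) ⟨
  ε * ∑[ i ≤ m ] ∑[ j ≤ n ] term i j
    ≡⟨ cong (ε *_) (⊛-truncated H kernel (truncate-lowˡ G G-gregory) (truncate-lowʳ G G-gregory) m n) ⟨
  ε * (H ⊛ kernel) (2 ℕ.+ m) (2 ℕ.+ n)
    -- Adding and subtracting `logs` produces the left side of `truncate-⊛-kernel`.
    ≡⟨ cong (ε *_) (ℚRing.//-rightDividesʳ logs _) ⟨
  ε * ((H ⊛ kernel) (2 ℕ.+ m) (2 ℕ.+ n) + logs - logs)
    ≡⟨ cong (λ q → ε * (q - logs)) (trans (truncate-⊛-kernel G G-gregory (2 ℕ.+ m) (2 ℕ.+ n)) (XYkernel-suc-suc (suc m) (suc n))) ⟩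
  ε * (kernel (suc m) (suc n) - logs)
    ≡⟨ ℚRing.x[y-z]≈xy-xz ε (kernel (suc m) (suc n)) logs ⟩
  ε * kernel (suc m) (suc n) - ε * logs
    ≡⟨ cong₂ _-_ (signed-kernel m n) (signed-log m n) ⟩
  1ℤ / (suc m ℕ.+ suc (suc n)) - 1ℤ / ((2 ℕ.+ m) ℕ.* (2 ℕ.+ n))
    ∎
  where
  open ≡-Reasoning
  H : Series
  H = truncate G

  term : Fin (suc m) → Fin (suc n) → ℚ
  term i j = H (2 ℕ.+ toℕ i) (2 ℕ.+ toℕ j) * kernel (m ∸ toℕ i) (n ∸ toℕ j)

  ε logs : ℚ
  ε    = sgn (m ℕ.+ n) / 1
  logs = log1+ (2 ℕ.+ m) * log1+ (2 ℕ.+ n)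

  signed-term : ∀ {i j} → i ≤ m → j ≤ n →
                (sgn (2 ℕ.+ i ℕ.+ (2 ℕ.+ j)) / suc (m ∸ i ℕ.+ (n ∸ j))) * G (2 ℕ.+ i) (2 ℕ.+ j) ≡
                ε * (H (2 ℕ.+ i) (2 ℕ.+ j) * kernel (m ∸ i) (n ∸ j))
  signed-term {i} {j} i≤m j≤n = begin
    (sgn (2 ℕ.+ i ℕ.+ (2 ℕ.+ j)) / suc p) * G (2 ℕ.+ i) (2 ℕ.+ j)
      ≡⟨ cong₂ (λ s g → (s / suc p) * g) (sgn-complement i≤m j≤n) (sym (truncate-high G i j)) ⟩
    ((sgn (m ℕ.+ n) ℤ.* sgn p) / suc p) * H (2 ℕ.+ i) (2 ℕ.+ j)
      -- `sgn p / suc p` is `kernel (m ∸ i) (n ∸ j)` by computation.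
      ≡⟨ cong (_* H (2 ℕ.+ i) (2 ℕ.+ j)) (/1-*-/ (sgn (m ℕ.+ n)) (sgn p) (suc p)) ⟨
    ε * kernel (m ∸ i) (n ∸ j) * H (2 ℕ.+ i) (2 ℕ.+ j)
      ≡⟨ ℚ.*-assoc ε _ _ ⟩
    ε * (kernel (m ∸ i) (n ∸ j) * H (2 ℕ.+ i) (2 ℕ.+ j))
      ≡⟨ cong (ε *_) (ℚ.*-comm (kernel (m ∸ i) (n ∸ j)) _) ⟩
    ε * (H (2 ℕ.+ i) (2 ℕ.+ j) * kernel (m ∸ i) (n ∸ j))
      ∎
    where
    p : ℕ
    p = m ∸ i ℕ.+ (n ∸ j)
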